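{- Let $G$ be a finite connected regularly diagonal undirected graph, with eulerian magnitude homology groups $\mathrm{EMH}_{k,k}(G)=0$ in all bidegrees $(k,k)$ for $k>n$. Then $G$ is the complete graph on $n+1$ vertices.
   Context: Undirected graphs are simple, and $R$ is a fixed commutative unital ring. For a finite connected undirected graph $G$ with vertex set $V(G)$, $d_G$ denotes the path metric. The length of a tuple $(x_0,\dots,x_k)$ of vertices is $\mathrm{len}(x_0,\dots,x_k)=\sum_{i=0}^{k-1}d_G(x_i,x_{i+1})$. The eulerian magnitude chain module $\mathrm{EMC}_{k,\ell}(G)$ is the free $R$-module on the tuples $(x_0,\dots,x_k)\in V(G)^{k+1}$ of pairwise distinct vertices of length $\ell$. The differential $\partial\colon \mathrm{EMC}_{k,\ell}(G)\to \mathrm{EMC}_{k-1,\ell}(G)$ is $\partial=\sum_{i=1}^{k-1}(-1)^i\partial_i$, where $\partial_i$ deletes the entry $x_i$ if the resulting tuple still has length $\ell$, and $\partial_i(x_0,\dots,x_k)=0$ otherwise. The eulerian magnitude homology is $\mathrm{EMH}_{k,\ell}(G)=H_k(\mathrm{EMC}_{*,\ell}(G),\partial)$. The graph $G$ is called regularly diagonal if $\mathrm{EMH}_{k,\ell}(G)=0$ for all $k\neq \ell$.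
   Formalization: The formal statement adds that EMH_{n,n}(G) is nonzero, so that n is the exact threshold; without it the claim fails, e.g. for the one-vertex graph with n = 5. Adjacency in the finite graph is taken to be decidable. -}

module Defs where

open import Algebra.Bundles using (CommutativeRing)
import Algebra.Properties.Semiring.Exp as Exp
import Algebra.Properties.Ring as RingProperties
open import Data.Fin.Base using (Fin; zero; suc; toℕ; inject₁)
import Data.Fin.Properties as Fin
open import Data.List.Base as List using (List; []; _∷_; _++_)
open import Data.List.Properties using (concatMap-++)
open import Data.Nat.Base using (ℕ; zero; suc; _+_; _≤_; z≤n; s≤s)
open import Data.Nat.Properties using (_≟_)
open import Data.Product.Base using (∃; _×_; _,_; proj₁; proj₂)
open import Data.Unit.Polymorphic.Base using (⊤)
open import Data.Vec.Base using (Vec; []; _∷_; removeAt)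
open import Data.Vec.Properties using (≡-dec)
open import Data.Vec.Relation.Unary.All using (All; []; _∷_)
open import Data.Vec.Relation.Unary.AllPairs using ([]; _∷_)
open import Data.Vec.Relation.Unary.Unique.Propositional using (Unique)
open import Function.Base using (_∘_)
open import Function.Bundles using (_↔_; _⇔_; Inverse)
open import Level using (0ℓ; _⊔_)
open import Relation.Binary.Bundles using (Setoid)
open import Relation.Binary.Core using (Rel)
open import Relation.Binary.Definitions using (Decidable; Symmetric; Irreflexive)
open import Relation.Binary.PropositionalEquality.Core as ≡ using (_≡_; _≢_)
import Relation.Binary.Reasoning.Setoid as SetoidReasoning
open import Relation.Nullary.Decidable.Core using (yes; no; ¬?; _×-dec_)
open import Relation.Nullary.Negation.Core using (contradiction)
import Relation.Unary as Unary

------------------------------------------------------------------------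
-- Finite simple graphs

-- Decidability of adjacency is automatic classically.
record Graph (m : ℕ) : Set₁ where
  field
    Adj    : Rel (Fin m) 0ℓ
    adj?   : Decidable Adj
    sym    : Symmetric Adj
    irrefl : Irreflexive _≡_ Adj

complete : ∀ n → Graph n
complete n = record
  { Adj    = _≢_
  ; adj?   = λ u v → ¬? (u Fin.≟ v)
  ; sym    = ≡.≢-sym
  ; irrefl = λ u≡v u≢v → u≢v u≡v
  }

infix 4 _≅_

record _≅_ {m n} (G : Graph m) (H : Graph n) : Set where
  field
    vertices  : Fin m ↔ Fin n
    adjacency : ∀ u v → Graph.Adj G u v ⇔
                        Graph.Adj H (Inverse.to vertices u) (Inverse.to vertices v)

module _ {m} (G : Graph m) where
  open Graph G

  Walk : ℕ → Rel (Fin m) 0ℓ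
  Walk zero    u v = u ≡ v
  Walk (suc n) u v = ∃ λ w → Adj u w × Walk n w v

  walk? : ∀ n → Decidable (Walk n)
  walk? zero    u v = u Fin.≟ v
  walk? (suc n) u v = Fin.any? λ w → adj? u w ×-dec walk? n w v

  Connected : Set
  Connected = ∀ u v → ∃ λ n → Walk n u v

------------------------------------------------------------------------
-- The path metric

IsLeast : (ℕ → Set) → ℕ → Set
IsLeast P n = P n × (∀ k → P k → n ≤ k)

least : {P : ℕ → Set} → Unary.Decidable P → ∀ n → P n → ∃ (IsLeast P)
least P? zero    p0 = 0 , p0 , λ _ _ → z≤n
least P? (suc n) pn with P? 0
... | yes p0 = 0 , p0 , λ _ _ → z≤n
... | no ¬p0 with least (P? ∘ suc) n pn
...   | k , pk , k≤ = suc k , pk , λ where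
          zero    p0 → contradiction p0 ¬p0
          (suc j) pj → s≤s (k≤ j pj)

module _ {m} (G : Graph m) (conn : Connected G) where

  shortest : ∀ u v → ∃ (IsLeast (λ n → Walk G n u v))
  shortest u v = least (λ n → walk? G n u v) (proj₁ (conn u v)) (proj₂ (conn u v))

  dist : Fin m → Fin m → ℕ
  dist u v = proj₁ (shortest u v)

  len : ∀ {k} → Vec (Fin m) (suc k) → ℕ
  len (x ∷ [])     = 0
  len (x ∷ y ∷ xs) = dist x y + len (y ∷ xs)

  record EulerianTuple (k l : ℕ) : Set where
    constructor tuple
    field
      entries  : Vec (Fin m) (suc k)
      distinct : Unique entries
      length≡  : len entries ≡ l

All-removeAt : ∀ {a p} {A : Set a} {P : A → Set p} {n} {xs : Vec A (suc n)}
               (i : Fin (suc n)) → All P xs → All P (removeAt xs i)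
All-removeAt                    zero    (px ∷ pxs) = pxs
All-removeAt {xs = _ ∷ _ ∷ _} (suc i) (px ∷ pxs) = px ∷ All-removeAt i pxs

Unique-removeAt : ∀ {a} {A : Set a} {n} {xs : Vec A (suc n)}
                  (i : Fin (suc n)) → Unique xs → Unique (removeAt xs i)
Unique-removeAt                    zero    (px ∷ pxs) = pxs
Unique-removeAt {xs = _ ∷ _ ∷ _} (suc i) (px ∷ pxs) =
  All-removeAt i px ∷ Unique-removeAt i pxs

------------------------------------------------------------------------
-- Eulerian magnitude chains and homology

module _ {c ℓ} (R : CommutativeRing c ℓ) {m} (G : Graph m) (conn : Connected G) where
  open CommutativeRing R
    using (Carrier; _≈_; 0#; 1#; -_; setoid; semiring; ring)
    renaming (_+_ to _+ᴿ_; _*_ to _*ᴿ_)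
  private module R = CommutativeRing R
  open Exp semiring using (_^_)
  open RingProperties ring using (-1*x≈-x)

  -- Formal R-linear combinations of tuples; two of them represent the
  -- same element of the free module when all their coefficients agree (_≋_).
  EMC : ℕ → ℕ → Set c
  EMC k l = List (Carrier × EulerianTuple G conn k l)

  coeff : ∀ {k l} → EMC k l → Vec (Fin m) (suc k) → Carrier
  coeff []              y = 0#
  coeff ((r , x) ∷ xs) y with ≡-dec Fin._≟_ (EulerianTuple.entries x) y
  ... | yes _ = r +ᴿ coeff xs y
  ... | no  _ = coeff xs y

  infix 4 _≋_
  _≋_ : ∀ {k l} → EMC k l → EMC k l → Set ℓ
  a ≋ b = ∀ y → coeff a y ≈ coeff b y

  infixr 7 _·_
  _·_ : ∀ {k l} → Carrier → EMC k l → EMC k l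
  r · a = List.map (λ (s , x) → (r *ᴿ s , x)) a

  -- ∂ᵢ on a basis tuple
  face : ∀ {k l} → Fin (suc (suc k)) → EulerianTuple G conn (suc k) l → EMC k l
  face {l = l} i (tuple x distinct _) with len G conn (removeAt x i) ≟ l
  ... | yes eq = (1# , tuple (removeAt x i) (Unique-removeAt i distinct) eq) ∷ []
  ... | no  _  = []

  -- On a tuple (x₀,…,x₍ₖ₊₁₎) the sum is over i = 1,…,k, written i = 1 + j with j : Fin k.
  ∂-tuple : ∀ {k l} → EulerianTuple G conn (suc k) l → EMC k l
  ∂-tuple {k} x = List.concat (List.tabulate {n = k} λ j →
    ((- 1#) ^ suc (toℕ j)) · face (suc (inject₁ j)) x)

  ∂ : ∀ {k l} → EMC (suc k) l → EMC k l
  ∂ = List.concatMap λ (r , x) → r · ∂-tuple x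

  -- The complex is zero in degree -1, so every 0-chain is a cycle.
  IsCycle : ∀ {k l} → EMC k l → Set ℓ
  IsCycle {zero}  a = ⊤
  IsCycle {suc k} a = ∂ a ≋ []

  record Cycle (k l : ℕ) : Set (c ⊔ ℓ) where
    constructor cycle
    field
      chain   : EMC k l
      isCycle : IsCycle chain

  infix 4 _∼_
  _∼_ : ∀ {k l} → Cycle k l → Cycle k l → Set (c ⊔ ℓ)
  _∼_ {k} {l} (cycle a _) (cycle b _) = ∃ λ (e : EMC (suc k) l) → a ≋ b ++ ∂ e

  zeroCycle : ∀ {k l} → Cycle k l
  zeroCycle {zero}  = cycle [] _
  zeroCycle {suc k} = cycle [] (λ _ → R.refl)

  coeff-++ : ∀ {k l} (a b : EMC k l) y → coeff (a ++ b) y ≈ coeff a y +ᴿ coeff b y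
  coeff-++ []             b y = R.sym (R.+-identityˡ _)
  coeff-++ ((r , x) ∷ a) b y with ≡-dec Fin._≟_ (EulerianTuple.entries x) y
  ... | yes _ = R.trans (R.+-congˡ (coeff-++ a b y)) (R.sym (R.+-assoc _ _ _))
  ... | no  _ = coeff-++ a b y

  coeff-· : ∀ {k l} r (a : EMC k l) y → coeff (r · a) y ≈ r *ᴿ coeff a y
  coeff-· r []             y = R.sym (R.zeroʳ r)
  coeff-· r ((s , x) ∷ a) y with ≡-dec Fin._≟_ (EulerianTuple.entries x) y
  ... | yes _ = R.trans (R.+-congˡ (coeff-· r a y)) (R.sym (R.distribˡ r s _))
  ... | no  _ = coeff-· r a y

  ∂-++ : ∀ {k l} (a b : EMC (suc k) l) y →
         coeff (∂ (a ++ b)) y ≈ coeff (∂ a) y +ᴿ coeff (∂ b) y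
  ∂-++ a b y = R.trans
    (R.reflexive (≡.cong (λ z → coeff z y) (concatMap-++ _ a b)))
    (coeff-++ (∂ a) (∂ b) y)

  ∂-· : ∀ {k l} r (a : EMC (suc k) l) y → coeff (∂ (r · a)) y ≈ r *ᴿ coeff (∂ a) y
  ∂-· r []             y = R.sym (R.zeroʳ r)
  ∂-· r ((s , x) ∷ a) y = begin
    coeff ((r *ᴿ s) · ∂-tuple x ++ ∂ (r · a)) y
      ≈⟨ coeff-++ ((r *ᴿ s) · ∂-tuple x) _ y ⟩
    coeff ((r *ᴿ s) · ∂-tuple x) y +ᴿ coeff (∂ (r · a)) y
      ≈⟨ R.+-cong (coeff-· (r *ᴿ s) (∂-tuple x) y) (∂-· r a y) ⟩
    ((r *ᴿ s) *ᴿ coeff (∂-tuple x) y) +ᴿ (r *ᴿ coeff (∂ a) y)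
      ≈⟨ R.+-congʳ (R.*-assoc r s _) ⟩
    (r *ᴿ (s *ᴿ coeff (∂-tuple x) y)) +ᴿ (r *ᴿ coeff (∂ a) y)
      ≈⟨ R.distribˡ r _ _ ⟨
    r *ᴿ ((s *ᴿ coeff (∂-tuple x) y) +ᴿ coeff (∂ a) y)
      ≈⟨ R.*-congˡ (R.+-congʳ (coeff-· s (∂-tuple x) y)) ⟨
    r *ᴿ (coeff (s · ∂-tuple x) y +ᴿ coeff (∂ a) y)
      ≈⟨ R.*-congˡ (coeff-++ (s · ∂-tuple x) (∂ a) y) ⟨
    r *ᴿ coeff (s · ∂-tuple x ++ ∂ a) y ∎
    where open SetoidReasoning setoid

  ∼-refl : ∀ {k l} {a : Cycle k l} → a ∼ a
  ∼-refl {a = cycle a _} = [] , λ y →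
    R.trans (R.sym (R.+-identityʳ _)) (R.sym (coeff-++ a [] y))

  ∼-sym : ∀ {k l} {a b : Cycle k l} → a ∼ b → b ∼ a
  ∼-sym {a = cycle a _} {b = cycle b _} (e , a≋b+∂e) = (- 1#) · e , λ y → begin
    coeff b y                                               ≈⟨ R.+-identityʳ _ ⟨
    coeff b y +ᴿ 0#                                         ≈⟨ R.+-congˡ (R.-‿inverseʳ _) ⟨
    coeff b y +ᴿ (coeff (∂ e) y +ᴿ - coeff (∂ e) y)         ≈⟨ R.+-assoc _ _ _ ⟨
    (coeff b y +ᴿ coeff (∂ e) y) +ᴿ - coeff (∂ e) y         ≈⟨ R.+-congʳ (coeff-++ b (∂ e) y) ⟨
    coeff (b ++ ∂ e) y +ᴿ - coeff (∂ e) y                   ≈⟨ R.+-congʳ (a≋b+∂e y) ⟨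
    coeff a y +ᴿ - coeff (∂ e) y                            ≈⟨ R.+-congˡ (-1*x≈-x _) ⟨
    coeff a y +ᴿ ((- 1#) *ᴿ coeff (∂ e) y)                  ≈⟨ R.+-congˡ (∂-· (- 1#) e y) ⟨
    coeff a y +ᴿ coeff (∂ ((- 1#) · e)) y                   ≈⟨ coeff-++ a _ y ⟨
    coeff (a ++ ∂ ((- 1#) · e)) y                           ∎
    where open SetoidReasoning setoid

  ∼-trans : ∀ {k l} {a b d : Cycle k l} → a ∼ b → b ∼ d → a ∼ d
  ∼-trans {a = cycle a _} {b = cycle b _} {d = cycle d _} (e , p) (f , q) = f ++ e , λ y → begin
    coeff a y                                               ≈⟨ p y ⟩
    coeff (b ++ ∂ e) y                                      ≈⟨ coeff-++ b _ y ⟩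
    coeff b y +ᴿ coeff (∂ e) y                              ≈⟨ R.+-congʳ (q y) ⟩
    coeff (d ++ ∂ f) y +ᴿ coeff (∂ e) y                     ≈⟨ R.+-congʳ (coeff-++ d _ y) ⟩
    (coeff d y +ᴿ coeff (∂ f) y) +ᴿ coeff (∂ e) y           ≈⟨ R.+-assoc _ _ _ ⟩
    coeff d y +ᴿ (coeff (∂ f) y +ᴿ coeff (∂ e) y)           ≈⟨ R.+-congˡ (∂-++ f e y) ⟨
    coeff d y +ᴿ coeff (∂ (f ++ e)) y                       ≈⟨ coeff-++ d _ y ⟨
    coeff (d ++ ∂ (f ++ e)) y                               ∎
    where open SetoidReasoning setoid

  -- The quotient of cycles by boundaries, as a setoid.
  EMH : ℕ → ℕ → Setoid (c ⊔ ℓ) (c ⊔ ℓ)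
  EMH k l = record
    { Carrier       = Cycle k l
    ; _≈_           = _∼_
    ; isEquivalence = record
      { refl  = λ {a} → ∼-refl {a = a}
      ; sym   = λ {a} {b} → ∼-sym {a = a} {b = b}
      ; trans = λ {a} {b} {d} → ∼-trans {a = a} {b = b} {d = d}
      }
    }

  EMHVanishes : ℕ → ℕ → Set (c ⊔ ℓ)
  EMHVanishes k l = ∀ (z : Setoid.Carrier (EMH k l)) → Setoid._≈_ (EMH k l) z zeroCycle

  RegularlyDiagonal : Set (c ⊔ ℓ)
  RegularlyDiagonal = ∀ k l → k ≢ l → EMHVanishes k l

{-# OPTIONS --safe #-}

-- Order all the vertices greedily, starting anywhere and always moving to a
-- farthest vertex not yet visited.  Then d(xᵢ₋₁,xᵢ₊₁) ≤ d(xᵢ₋₁,xᵢ) < d(xᵢ₋₁,xᵢ) + d(xᵢ,xᵢ₊₁),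
-- so every face of the tuple is zero.  No tuple of distinct vertices is longer,
-- so this cycle is not a boundary: EMH_{m-1,l} ≠ 0, where m is the number of
-- vertices and l the length of the tuple.  Diagonality forces l = m - 1; hence
-- m - 1 ≤ n, and m - 1 ≥ n since EMH_{n,n} ≠ 0.  If u and v were distinct and not
-- adjacent, the greedy tuple from u would begin with a step of length ≥ 2, whence l > m - 1.

module Submission where

open import Algebra.Bundles using (CommutativeRing)
open import Data.Fin.Base using (Fin; zero; suc; inject₁; punchIn; punchOut)
import Data.Fin.Properties as Fin
import Data.List.Base as List
open import Data.List.Base using ([]; _∷_)
open import Data.List.Extrema.Nat using (argmax; f[xs]≤f[argmax])
open import Data.List.Membership.Propositional.Properties using (∈-allFin)
open import Data.List.Relation.Unary.All as ListAll using ()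
open import Data.Nat.Base using (ℕ; zero; suc; _+_; _≤_; _<_; _>_; z≤n; s≤s; z<s; s<s)
import Data.Nat.Properties as ℕ
open import Data.Product.Base using (∃; _×_; _,_; proj₁; proj₂)
open import Data.Vec.Base using (Vec; []; _∷_; lookup; removeAt; tabulate)
open import Data.Vec.Membership.Propositional using (_∈_)
open import Data.Vec.Membership.Propositional.Properties using (∈-lookup)
open import Data.Vec.Properties using (≡-dec)
open import Data.Vec.Relation.Unary.All as All using (All; []; _∷_)
import Data.Vec.Relation.Unary.All.Properties as All
open import Data.Vec.Relation.Unary.AllPairs using ([]; _∷_)
open import Data.Vec.Relation.Unary.Unique.Propositional using (Unique)
import Data.Vec.Relation.Unary.Unique.Propositional.Properties as Unique
open import Function.Base using (_∘_)
open import Function.Bundles using (_⇔_; mk⇔; Equivalence)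
import Function.Construct.Identity as Identity
open import Level using (0ℓ)
open import Relation.Binary.Definitions using (tri<; tri≈; tri>)
open import Relation.Binary.PropositionalEquality.Core
  using (_≡_; _≢_; refl; sym; cong; subst; ≢-sym)
open import Relation.Nullary.Decidable.Core using (yes; no)
open import Relation.Nullary.Negation.Core using (¬_; contradiction)
open import Relation.Unary using (Pred)
open import Defs

private
  variable
    A : Set
    k l m : ℕ

All-insertAt : {P : Pred A 0ℓ} {xs : Vec A (suc k)} (i : Fin (suc k)) →
               P (lookup xs i) → All P (removeAt xs i) → All P xs
All-insertAt {xs = _ ∷ _}     zero    p ps       = p ∷ ps
All-insertAt {xs = _ ∷ _ ∷ _} (suc i) p (q ∷ qs) = q ∷ All-insertAt i p qs

Unique⇒≢-removeAt : {xs : Vec A (suc k)} (i : Fin (suc k)) → Unique xs →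
                    All (lookup xs i ≢_) (removeAt xs i)
Unique⇒≢-removeAt {xs = _ ∷ _}     zero    (x∉ ∷ _)  = x∉
Unique⇒≢-removeAt {xs = _ ∷ _ ∷ _} (suc i) (x∉ ∷ xs!) =
  ≢-sym (All.lookup⁺ x∉ i) ∷ Unique⇒≢-removeAt i xs!

-- Pigeonhole: `lookup` into a vector of distinct entries is injective.
Unique⇒length≤ : {xs : Vec (Fin m) k} → Unique xs → k ≤ m
Unique⇒length≤ xs! = Fin.injective⇒≤ λ {i} {j} → Unique.lookup-injective xs! i j

-- Opaque because normalising the with-abstraction in farthestFirst is otherwise intractable.
opaque
  maximiser : (f : Fin (suc k) → ℕ) → ∃ λ i → ∀ j → f j ≤ f i
  maximiser f = argmax f zero (List.allFin _) , λ j →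
    ListAll.lookup (f[xs]≤f[argmax] {f = f} zero (List.allFin _)) (∈-allFin j)

others : Fin (suc k) → Vec (Fin (suc k)) k
others u = tabulate (punchIn u)

others-unique : (u : Fin (suc k)) → Unique (others u)
others-unique u = Unique.tabulate⁺ (Fin.punchIn-injective u _ _)

∉others : (u : Fin (suc k)) → All (u ≢_) (others u)
∉others u = All.tabulate⁺ λ j → ≢-sym (Fin.punchInᵢ≢i u j)

All-others⇒ : {P : Pred (Fin (suc k)) 0ℓ} {u v : Fin (suc k)} →
              All P (others u) → u ≢ v → P v
All-others⇒ {P = P} ps u≢v =
  subst P (Fin.punchIn-punchOut u≢v) (All.tabulate⁻ ps (punchOut u≢v))

module _ (G : Graph m) (conn : Connected G) where
  open Graph G using (Adj)

  private
    d : Fin m → Fin m → ℕ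
    d = dist G conn

  dist-walk : ∀ u v → Walk G (d u v) u v
  dist-walk u v = proj₁ (proj₂ (shortest G conn u v))

  Walk⇒0< : ∀ n {u v} → u ≢ v → Walk G n u v → 0 < n
  Walk⇒0< zero    u≢v u≡v = contradiction u≡v u≢v
  Walk⇒0< (suc _) _   _   = z<s

  Walk⇒1< : ∀ n {u v} → u ≢ v → ¬ Adj u v → Walk G n u v → 1 < n
  Walk⇒1< zero          u≢v _  u≡v             = contradiction u≡v u≢v
  Walk⇒1< (suc zero)    _   ¬a (_ , a , refl) = contradiction a ¬a
  Walk⇒1< (suc (suc _)) _   _  _               = s<s z<s

  dist>0 : ∀ {u v} → u ≢ v → 0 < d u v
  dist>0 u≢v = Walk⇒0< _ u≢v (dist-walk _ _)

  dist>1 : ∀ {u v} → u ≢ v → ¬ Adj u v → 1 < d u v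
  dist>1 u≢v ¬a = Walk⇒1< _ u≢v ¬a (dist-walk _ _)

  -- Each of the `k` steps joins distinct vertices, so it contributes at least 1.
  len≥ : {xs : Vec (Fin m) (suc k)} → Unique xs → k ≤ len G conn xs
  len≥ {xs = _ ∷ []}    _                  = z≤n
  len≥ {xs = _ ∷ _ ∷ _} ((x≢y ∷ _) ∷ xs!) = ℕ.+-mono-≤ (dist>0 x≢y) (len≥ xs!)

  data FarthestFirst : ∀ {k} → Vec (Fin m) (suc k) → Set where
    [-] : ∀ {x} → FarthestFirst (x ∷ [])
    _∷_ : ∀ {k x y} {ys : Vec (Fin m) k} → All (λ z → d x z ≤ d x y) ys →
          FarthestFirst (y ∷ ys) → FarthestFirst (x ∷ y ∷ ys)

  -- The index `suc (inject₁ j)` runs exactly through the interior positions, whose faces make up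
  -- the differential.
  len-removeAt< : {xs : Vec (Fin m) (suc (suc k))} → Unique xs → FarthestFirst xs →
                  (j : Fin k) → len G conn (removeAt xs (suc (inject₁ j))) < len G conn xs
  len-removeAt< {xs = x ∷ y ∷ z ∷ zs} (_ ∷ (y≢z ∷ _) ∷ _) ((xz≤xy ∷ _) ∷ _) zero = begin-strict
    d x z + len G conn (z ∷ zs)           ≤⟨ ℕ.+-monoˡ-≤ _ xz≤xy ⟩
    -- Strictness: the step from `y` to `z` has positive length.
    d x y + len G conn (z ∷ zs)           <⟨ ℕ.+-monoʳ-< (d x y) (ℕ.m<n+m _ (dist>0 y≢z)) ⟩
    d x y + (d y z + len G conn (z ∷ zs)) ∎
    where open ℕ.≤-Reasoning
  len-removeAt< {xs = x ∷ y ∷ _ ∷ _} (_ ∷ xs!) (_ ∷ ff) (suc j) =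
    ℕ.+-monoʳ-< (d x y) (len-removeAt< xs! ff j)

  -- The clause on P says that zs has the same entries as ys.
  farthestFirst : ∀ x (ys : Vec (Fin m) k) → Unique ys →
    ∃ λ (zs : Vec (Fin m) k) → (∀ {P : Pred (Fin m) 0ℓ} → All P ys ⇔ All P zs) ×
             Unique zs × FarthestFirst (x ∷ zs)
  farthestFirst x [] [] = [] , mk⇔ (λ p → p) (λ p → p) , [] , [-]
  farthestFirst {k = suc k} x ys@(_ ∷ _) ys!
    with i , max ← maximiser (d x ∘ lookup ys)
    with zs , same , zs! , ff ← farthestFirst (lookup ys i) (removeAt ys i) (Unique-removeAt i ys!)
    = lookup ys i ∷ zs
    , mk⇔ (λ ps → All.lookup⁺ ps i ∷ Equivalence.to same (All-removeAt {xs = ys} i ps))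
          (λ { (p ∷ ps) → All-insertAt {xs = ys} i p (Equivalence.from same ps) })
    -- Since `same` holds for every predicate, it carries to the reordered rest `zs` both that the
    -- chosen entry differs from all others and that it is farthest from `x`.
    , Equivalence.to same (Unique⇒≢-removeAt i ys!) ∷ zs!
    , Equivalence.to same (All-removeAt {xs = ys} i (All.lookup⁻ max)) ∷ ff

  -- The greedy first step is at least as long as `d x z`, hence at least 2; every other step is at
  -- least 1.
  FarthestFirst-len : ∀ {x z} {zs : Vec (Fin m) k} → Unique (x ∷ zs) → FarthestFirst (x ∷ zs) →
                      z ∈ zs → 1 < d x z → k < len G conn (x ∷ zs)
  FarthestFirst-len {zs = _ ∷ _} (_ ∷ zs!) (≤xy ∷ _) z∈zs 1<xz =
    -- `ℕ.≤-refl` covers the case that `z` is itself the first entry visited.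
    ℕ.+-mono-≤ (ℕ.≤-trans 1<xz (All.lookup (ℕ.≤-refl ∷ ≤xy) z∈zs)) (len≥ zs!)

  module _ {c ℓ} (R : CommutativeRing c ℓ) where
    open CommutativeRing R using (_≈_; 0#; 1#)
    private module R = CommutativeRing R

    coeff≈0 : 1# ≈ 0# → (a : EMC R G conn k l) → ∀ y → coeff R G conn a y ≈ 0#
    coeff≈0 1≈0 a y = R.trans (R.sym (R.*-identityˡ _)) (R.trans (R.*-congʳ 1≈0) (R.zeroˡ _))

    ≋[]⇒∼zeroCycle : (z : Cycle R G conn k l) →
                     _≋_ R G conn (Cycle.chain z) [] → _∼_ R G conn z (zeroCycle R G conn)
    -- The split on the degree only lets `zeroCycle` compute; the empty chain bounds in both cases.
    ≋[]⇒∼zeroCycle {k = zero}  z z≋[] = [] , z≋[]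
    ≋[]⇒∼zeroCycle {k = suc _} z z≋[] = [] , z≋[]

    -- Used contrapositively: one nonvanishing group forces the ring to be nontrivial.
    trivialRing⇒EMHVanishes : 1# ≈ 0# → EMHVanishes R G conn k l
    trivialRing⇒EMHVanishes 1≈0 z = ≋[]⇒∼zeroCycle z (coeff≈0 1≈0 (Cycle.chain z))

    -- A tuple in degree `k` has `k + 1` distinct entries, more than the `m` vertices allow.
    tooManyVertices⇒[] : m ≤ k → (a : EMC R G conn k l) → a ≡ []
    tooManyVertices⇒[] m≤k []            = refl
    tooManyVertices⇒[] m≤k ((_ , x) ∷ _) =
      contradiction (Unique⇒length≤ (EulerianTuple.distinct x)) (ℕ.<⇒≱ (s≤s m≤k))

    tooManyVertices⇒EMHVanishes : m ≤ k → EMHVanishes R G conn k l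
    tooManyVertices⇒EMHVanishes m≤k z@(cycle a _) = ≋[]⇒∼zeroCycle z λ y →
      R.reflexive (cong (λ b → coeff R G conn b y) (tooManyVertices⇒[] m≤k a))

    allFacesShorter⇒∂-tuple≡[] : (x : EulerianTuple G conn (suc k) l) →
      (∀ j → len G conn (removeAt (EulerianTuple.entries x) (suc (inject₁ j))) < l) →
      ∂-tuple R G conn x ≡ []
    allFacesShorter⇒∂-tuple≡[] {k = k} {l = l} x shorter = concat-[] λ j →
      cong (_·_ R G conn _) (face≡[] j)
      where
      face≡[] : ∀ j → face R G conn (suc (inject₁ j)) x ≡ []
      face≡[] j with len G conn (removeAt (EulerianTuple.entries x) (suc (inject₁ j))) ℕ.≟ l
      ... | yes eq = contradiction eq (ℕ.<⇒≢ (shorter j))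
      ... | no  _  = refl

      concat-[] : ∀ {a} {B : Set a} {n} {f : Fin n → List.List B} →
                  (∀ j → f j ≡ []) → List.concat (List.tabulate f) ≡ []
      concat-[] {n = zero}          f≡[] = refl
      concat-[] {n = suc _} {f = f} f≡[] rewrite f≡[] zero = concat-[] (f≡[] ∘ suc)

    FarthestFirst⇒IsCycle : (x : EulerianTuple G conn k l) →
      FarthestFirst (EulerianTuple.entries x) → IsCycle R G conn ((1# , x) ∷ [])
    FarthestFirst⇒IsCycle {k = zero}  _ _ = _
    FarthestFirst⇒IsCycle {k = suc _} x@(tuple _ xs! refl) ff y
      rewrite allFacesShorter⇒∂-tuple≡[] x (len-removeAt< xs! ff) = R.refl

    coeff-self : (x : EulerianTuple G conn k l) →
                 coeff R G conn ((1# , x) ∷ []) (EulerianTuple.entries x) ≈ 1#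
    coeff-self x with ≡-dec Fin._≟_ (EulerianTuple.entries x) (EulerianTuple.entries x)
    ... | yes _  = R.+-identityʳ 1#
    ... | no x≢x = contradiction refl x≢x

    coeff-zeroCycle : ∀ y → coeff R G conn (Cycle.chain (zeroCycle R G conn {k} {l})) y ≈ 0#
    coeff-zeroCycle {k = zero}  y = R.refl
    coeff-zeroCycle {k = suc _} y = R.refl

    -- There is no room for a tuple with one more vertex, so nothing bounds x.
    spanning⇒¬EMHVanishes : m ≤ suc k → ¬ 1# ≈ 0# → (x : EulerianTuple G conn k l) →
      FarthestFirst (EulerianTuple.entries x) → ¬ EMHVanishes R G conn k l
    spanning⇒¬EMHVanishes {k = k} {l = l} m≤1+k 1≉0 x ff vanishes
      with e , x≋∂e ← vanishes (cycle ((1# , x) ∷ []) (FarthestFirst⇒IsCycle x ff))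
      rewrite tooManyVertices⇒[] m≤1+k e
      -- With `e` empty, the coefficients at the entries of `x` are `1#` on the left and `0#` on the
      -- right.
      = 1≉0 (R.trans (R.sym (coeff-self x)) (R.trans (x≋∂e _)
          (R.trans (coeff-++ R G conn (Cycle.chain (zeroCycle R G conn {k} {l})) [] _)
            (R.trans (R.+-identityʳ _) (coeff-zeroCycle {k} {l} _)))))

module _ {c ℓ} (R : CommutativeRing c ℓ) {p : ℕ} (G : Graph (suc p)) (conn : Connected G)
         (1≉0 : ¬ CommutativeRing._≈_ R (CommutativeRing.1# R) (CommutativeRing.0# R))
         (diagonal : RegularlyDiagonal R G conn) where
  open Graph G using (Adj; adj?)

  private
    -- The start is a parameter because the proof that `u` is adjacent to `v` needs the tuple that
    -- begins at `u`.
    module Greedy (u : Fin (suc p)) where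
      private greedy = farthestFirst G conn u (others u) (others-unique u)

      path : Vec (Fin (suc p)) p
      path = proj₁ greedy

      same : ∀ {P : Pred (Fin (suc p)) 0ℓ} → All P (others u) ⇔ All P path
      same = proj₁ (proj₂ greedy)

      unique : Unique (u ∷ path)
      unique = Equivalence.to same (∉others u) ∷ proj₁ (proj₂ (proj₂ greedy))

      -- Every entry of `path` lies in `path`; `same` transfers this predicate back to all vertices
      -- other than `u`.
      ∈path : ∀ {v} → u ≢ v → v ∈ path
      ∈path = All-others⇒ {P = _∈ path} (Equivalence.from same (All.lookup⁻ λ i → ∈-lookup i path))

      ff : FarthestFirst G conn (u ∷ path)
      ff = proj₂ (proj₂ (proj₂ greedy))

      ¬vanishes : ¬ EMHVanishes R G conn p (len G conn (u ∷ path))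
      ¬vanishes = spanning⇒¬EMHVanishes G conn R ℕ.≤-refl 1≉0 (tuple (u ∷ path) unique refl) ff

      len≡ : p ≡ len G conn (u ∷ path)
      len≡ with p ℕ.≟ len G conn (u ∷ path)
      ... | yes eq = eq
      ... | no neq = contradiction (diagonal _ _ neq) ¬vanishes

  diagonal⇒¬EMHVanishes-top : ¬ EMHVanishes R G conn p p
  diagonal⇒¬EMHVanishes-top =
    subst (λ l → ¬ EMHVanishes R G conn p l) (sym len≡) ¬vanishes
    where open Greedy zero

  diagonal⇒Adj : ∀ {u v} → u ≢ v → Adj u v
  diagonal⇒Adj {u} {v} u≢v with adj? u v
  ... | yes a = a
  ... | no ¬a = contradiction len≡ (ℕ.<⇒≢ (FarthestFirst-len G conn
          unique ff (∈path u≢v) (dist>1 G conn u≢v ¬a)))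
    where open Greedy u

  diagonal⇒complete : G ≅ complete (suc p)
  diagonal⇒complete = record
    { vertices  = Identity.↔-id _
    ; adjacency = λ u v → mk⇔ (λ a u≡v → Graph.irrefl G u≡v a) diagonal⇒Adj
    }

theorem2p12 : ∀ {c ℓ} (R : CommutativeRing c ℓ) {m : ℕ} (G : Graph m) (conn : Connected G) →
    RegularlyDiagonal R G conn →
    (n : ℕ) →
    (∀ k → k > n → EMHVanishes R G conn k k) →
    ¬ EMHVanishes R G conn n n →
    G ≅ complete (suc n)
-- Without vertices there are no tuples, so every group vanishes.
theorem2p12 R {zero}  G conn diagonal n _ ¬vanishes =
  contradiction (tooManyVertices⇒EMHVanishes G conn R z≤n) ¬vanishes
theorem2p12 R {suc p} G conn diagonal n above ¬vanishes with ℕ.<-cmp p n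
-- Here `p + 1 ≤ n`, so degree `n` has no tuples at all.
... | tri< p<n _ _  = contradiction (tooManyVertices⇒EMHVanishes G conn R p<n) ¬vanishes
... | tri≈ _ refl _ =
  diagonal⇒complete R G conn (¬vanishes ∘ trivialRing⇒EMHVanishes G conn R) diagonal
-- The greedy class in bidegree `(p , p)` survives, although `p > n`.
... | tri> _ _ p>n  = contradiction (above p p>n)
  (diagonal⇒¬EMHVanishes-top R G conn (¬vanishes ∘ trivialRing⇒EMHVanishes G conn R) diagonal)
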